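{- Let $g \ge h \ge 2$ be integers. If $n \geq 1$ is an integer and $A \subset [n]$ is a $C_h[g]$-set in $\mathbb{Z}$, then $$|A| \le (g-1)^{1/h}\, n^{1-1/h} + O\left(n^{1/2 - 1/(2h)}\right),$$ where the implied constant depends only on $g$ and $h$.
   Context: $[n] = \{1,2,\dots,n\}$. Let $\Gamma$ be an abelian group and $g \geq h \geq 2$ integers. A set $A \subset \Gamma$ is a $C_h[g]$-set if, for any set $X \subset \Gamma$ with $|X| = h$ and any set $\{k_1,\dots,k_g\} \subset \Gamma$ of $g$ distinct elements, at least one of the translates $X + k_i := \{x + k_i : x \in X\}$ is not contained in $A$. Here $\Gamma = \mathbb{Z}$. -}

module Defs where

open import Algebra.Bundles using (AbelianGroup)
open import Data.Fin.Base using (Fin; toℕ)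
open import Data.Fin.Subset using (Subset) renaming (_∈_ to _∈ₛ_)
open import Data.Integer.Base using (ℤ; +_)
open import Data.Nat.Base as ℕ using (ℕ; zero; suc)
open import Data.Product.Base using (∃-syntax; _×_; _,_; proj₁; proj₂)
open import Data.Rational.Base as ℚ
  using (ℚ; 0ℚ; 1ℚ; +-*-rawSemiring; positive; nonNegative; _÷_)
import Data.Rational.Properties as ℚ
open import Data.Sum.Base using (inj₁; inj₂)
open import Function.Definitions using (Injective)
open import Level using (_⊔_)
open import Relation.Binary.PropositionalEquality
  using (_≡_; sym; trans; cong; subst)
open import Relation.Unary using (Pred; _∈_; _⊆_; _⊈_)

open import Algebra.Definitions.RawSemiring +-*-rawSemiring using (_^_)

private
  variable
    b p q r s : ℚ

------------------------------------------------------------------------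
-- C_h[g]-sets

module _ {c ℓ} (Γ : AbelianGroup c ℓ) where

  open AbelianGroup Γ using (Carrier; _≈_; _∙_)

  -- An m-element subset of Γ is given by an injective enumeration
  -- Fin m → Carrier; the translate is X + k for the X enumerated by x.
  translate : ∀ {m} → (Fin m → Carrier) → Carrier → Pred Carrier ℓ
  translate x k z = ∃[ j ] z ≈ x j ∙ k

  IsC : (h g : ℕ) → ∀ {a} → Pred Carrier a → Set (c ⊔ ℓ ⊔ a)
  IsC h g A =
    (x : Fin h → Carrier) → Injective _≡_ _≈_ x →
    (k : Fin g → Carrier) → Injective _≡_ _≈_ k →
    ∃[ i ] translate x (k i) ⊈ A

-- Subset n consists of subsets of Fin n = {0,…,n-1}; i stands for the
-- element i + 1 of [n] = {1,…,n}.
⟦_⟧ : ∀ {n} → Subset n → Pred ℤ _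
⟦ A ⟧ z = ∃[ i ] (i ∈ₛ A × z ≡ + suc (toℕ i))

------------------------------------------------------------------------
-- Facts about rational powers

private abstract

  *-mono-≤ : 0ℚ ℚ.≤ p → 0ℚ ℚ.≤ s → p ℚ.≤ q → r ℚ.≤ s → p ℚ.* r ℚ.≤ q ℚ.* s
  *-mono-≤ {p} {s} 0≤p 0≤s p≤q r≤s = ℚ.≤-trans
    (ℚ.*-monoˡ-≤-nonNeg p {{nonNegative 0≤p}} r≤s)
    (ℚ.*-monoʳ-≤-nonNeg s {{nonNegative 0≤s}} p≤q)

  *-pos : 0ℚ ℚ.< p → 0ℚ ℚ.< q → 0ℚ ℚ.< p ℚ.* q
  *-pos {p} {q} 0<p 0<q = ℚ.positive⁻¹ (p ℚ.* q)
    {{ℚ.pos*pos⇒pos p {{positive 0<p}} q {{positive 0<q}}}}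

  ^-pos : ∀ k p → 0ℚ ℚ.< p → 0ℚ ℚ.< p ^ k
  ^-pos zero    p 0<p = ℚ.positive⁻¹ 1ℚ
  ^-pos (suc k) p 0<p = *-pos 0<p (^-pos k p 0<p)

  ^-mono-≤ : ∀ k p q → 0ℚ ℚ.< p → p ℚ.≤ q → p ^ k ℚ.≤ q ^ k
  ^-mono-≤ zero    p q 0<p p≤q = ℚ.≤-refl
  ^-mono-≤ (suc k) p q 0<p p≤q = *-mono-≤ (ℚ.<⇒≤ 0<p)
    (ℚ.<⇒≤ (^-pos k q (ℚ.<-≤-trans 0<p p≤q))) p≤q (^-mono-≤ k p q 0<p p≤q)

  1≤^ : ∀ k p → 1ℚ ℚ.≤ p → 1ℚ ℚ.≤ p ^ k
  1≤^ zero    p 1≤p = ℚ.≤-refl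
  1≤^ (suc k) p 1≤p = *-mono-≤ (ℚ.<⇒≤ 0<1) (ℚ.≤-trans (ℚ.<⇒≤ 0<1) (1≤^ k p 1≤p))
    1≤p (1≤^ k p 1≤p)
    where
    0<1 : 0ℚ ℚ.< 1ℚ
    0<1 = ℚ.positive⁻¹ 1ℚ

  ^-large : ∀ k s → 0ℚ ℚ.< s → ∃[ q ] (0ℚ ℚ.< q × s ℚ.≤ q ^ suc k)
  ^-large k s 0<s with ℚ.≤-total s 1ℚ
  ... | inj₁ s≤1 = 1ℚ , ℚ.positive⁻¹ 1ℚ ,
          ℚ.≤-trans s≤1 (1≤^ (suc k) 1ℚ ℚ.≤-refl)
  ... | inj₂ 1≤s = s , 0<s ,
          subst (ℚ._≤ s ^ suc k) (ℚ.*-identityʳ s)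
            (ℚ.*-monoˡ-≤-nonNeg s {{nonNegative (ℚ.<⇒≤ 0<s)}} (1≤^ k s 1≤s))

  shrinkˡ : 0ℚ ℚ.< b → 0ℚ ℚ.< q → b ℚ.< p ℚ.* q →
            ∃[ p′ ] (0ℚ ℚ.< p′ × p′ ℚ.< p × b ℚ.< p′ ℚ.* q)
  shrinkˡ {b} {q} {p} 0<b 0<q b<pq = shrink (ℚ.<-dense b/q<p)
    where
    instance
      q-pos : ℚ.Positive q
      q-pos = positive 0<q
      q-nonNeg : ℚ.NonNegative q
      q-nonNeg = ℚ.pos⇒nonNeg q
      q-nonZero : ℚ.NonZero q
      q-nonZero = ℚ.pos⇒nonZero q

    b≡ : b ÷ q ℚ.* q ≡ b
    b≡ = trans (ℚ.*-assoc b (ℚ.1/ q) q)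
           (trans (cong (b ℚ.*_) (ℚ.*-inverseˡ q)) (ℚ.*-identityʳ b))

    0<b/q : 0ℚ ℚ.< b ÷ q
    0<b/q = *-pos 0<b (ℚ.positive⁻¹ (ℚ.1/ q) {{ℚ.1/pos⇒pos q}})

    b/q<p : b ÷ q ℚ.< p
    b/q<p = ℚ.*-cancelʳ-<-nonNeg q {b ÷ q} {p}
              (subst (ℚ._< p ℚ.* q) (sym b≡) b<pq)

    shrink : ∃[ p′ ] (b ÷ q ℚ.< p′ × p′ ℚ.< p) →
             ∃[ p′ ] (0ℚ ℚ.< p′ × p′ ℚ.< p × b ℚ.< p′ ℚ.* q)
    shrink (p′ , b/q<p′ , p′<p) = p′ , ℚ.<-trans 0<b/q b/q<p′ , p′<p ,
      subst (ℚ._< p′ ℚ.* q) b≡ (ℚ.*-monoˡ-<-pos q {b ÷ q} {p′} b/q<p′)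

  ^-shrink : ∀ k b q → 0ℚ ℚ.< b → 0ℚ ℚ.< q → b ℚ.< q ^ k →
             ∃[ q′ ] (0ℚ ℚ.< q′ × q′ ℚ.< q × b ℚ.< q′ ^ k)
  ^-shrink zero b q 0<b 0<q b<1 with q′ , 0<q′ , q′<q ← ℚ.<-dense 0<q =
    q′ , 0<q′ , q′<q , b<1
  ^-shrink (suc k) b q 0<b 0<q b<q^
    with u , 0<u , u<q , b<uq^ ← shrinkˡ 0<b (^-pos k q 0<q) b<q^
    with v , 0<v , v<q^ , b<vu ←
      shrinkˡ 0<b 0<u (subst (b ℚ.<_) (ℚ.*-comm u (q ^ k)) b<uq^)
    with w , 0<w , w<q , v<w^ ← ^-shrink k v q 0<v 0<q v<q^
    with ℚ.≤-total u w
  ... | inj₁ u≤w = w , 0<w , w<q , ℚ.<-≤-trans b<vu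
          (subst (v ℚ.* u ℚ.≤_) (ℚ.*-comm (w ^ k) w)
            (*-mono-≤ (ℚ.<⇒≤ 0<v) (ℚ.<⇒≤ 0<w) (ℚ.<⇒≤ v<w^) u≤w))
  ... | inj₂ w≤u = u , 0<u , u<q , ℚ.<-≤-trans b<vu
          (subst (v ℚ.* u ℚ.≤_) (ℚ.*-comm (u ^ k) u)
            (*-mono-≤ (ℚ.<⇒≤ 0<v) (ℚ.<⇒≤ 0<u)
              (ℚ.≤-trans (ℚ.<⇒≤ v<w^) (^-mono-≤ k w u 0<w w≤u)) ℚ.≤-refl))

------------------------------------------------------------------------
-- Non-negative real numbers

-- A non-negative real α is the Dedekind cut {q ∈ ℚ : α < q}.  One-sided
-- cuts of this kind are classically all of [0,∞); no lower cut is needed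
-- for the order, sums, products and roots of non-negative numbers.
record ℝ≥0 : Set₁ where
  field
    above     : Pred ℚ _
    pos       : q ∈ above → 0ℚ ℚ.< q
    inhabited : ∃[ q ] q ∈ above
    up-closed : q ∈ above → q ℚ.≤ r → r ∈ above
    rounded   : q ∈ above → ∃[ r ] (r ∈ above × r ℚ.< q)

open ℝ≥0

infix  4 _≤_
infixl 6 _+_
infixl 7 _*_
infixr 8 _^ℕ_ _^1/_ _^[_/_]

_≤_ : ℝ≥0 → ℝ≥0 → Set
x ≤ y = above y ⊆ above x

fromℕ : ℕ → ℝ≥0
fromℕ m .above q     = + m ℚ./ 1 ℚ.< q
fromℕ m .pos m<q     = ℚ.≤-<-trans
  (ℚ.nonNegative⁻¹ (+ m ℚ./ 1) {{ℚ.normalize-nonNeg m 1}}) m<q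
fromℕ m .inhabited   = + m ℚ./ 1 ℚ.+ 1ℚ ,
  subst (ℚ._< + m ℚ./ 1 ℚ.+ 1ℚ) (ℚ.+-identityʳ (+ m ℚ./ 1))
    (ℚ.+-monoʳ-< (+ m ℚ./ 1) (ℚ.positive⁻¹ 1ℚ))
fromℕ m .up-closed   = ℚ.<-≤-trans
fromℕ m .rounded m<q = ℚ.<-dense m<q

_+_ : ℝ≥0 → ℝ≥0 → ℝ≥0
(x + y) .above q = ∃[ s ] ∃[ t ] (s ∈ above x × t ∈ above y × s ℚ.+ t ℚ.≤ q)
(x + y) .pos (s , t , s∈x , t∈y , s+t≤q) =
  ℚ.<-≤-trans (ℚ.+-mono-< (pos x s∈x) (pos y t∈y)) s+t≤q
(x + y) .inhabited with s , s∈x ← inhabited x | t , t∈y ← inhabited y =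
  s ℚ.+ t , s , t , s∈x , t∈y , ℚ.≤-refl
(x + y) .up-closed (s , t , s∈x , t∈y , s+t≤q) q≤r =
  s , t , s∈x , t∈y , ℚ.≤-trans s+t≤q q≤r
(x + y) .rounded (s , t , s∈x , t∈y , s+t≤q)
  with s′ , s′∈x , s′<s ← rounded x s∈x =
  s′ ℚ.+ t , (s′ , t , s′∈x , t∈y , ℚ.≤-refl) ,
  ℚ.<-≤-trans (ℚ.+-monoˡ-< t s′<s) s+t≤q

_*_ : ℝ≥0 → ℝ≥0 → ℝ≥0
(x * y) .above q = ∃[ s ] ∃[ t ] (s ∈ above x × t ∈ above y × s ℚ.* t ℚ.≤ q)
(x * y) .pos (s , t , s∈x , t∈y , st≤q) =
  ℚ.<-≤-trans (*-pos (pos x s∈x) (pos y t∈y)) st≤q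
(x * y) .inhabited with s , s∈x ← inhabited x | t , t∈y ← inhabited y =
  s ℚ.* t , s , t , s∈x , t∈y , ℚ.≤-refl
(x * y) .up-closed (s , t , s∈x , t∈y , st≤q) q≤r =
  s , t , s∈x , t∈y , ℚ.≤-trans st≤q q≤r
(x * y) .rounded (s , t , s∈x , t∈y , st≤q)
  with s′ , s′∈x , s′<s ← rounded x s∈x =
  s′ ℚ.* t , (s′ , t , s′∈x , t∈y , ℚ.≤-refl) ,
  ℚ.<-≤-trans (ℚ.*-monoˡ-<-pos t {{positive (pos y t∈y)}} s′<s) st≤q

_^ℕ_ : ℝ≥0 → ℕ → ℝ≥0
x ^ℕ zero  = fromℕ 1
x ^ℕ suc k = x * x ^ℕ k

-- The k-th root: q lies above it iff q > 0 and q ^ k lies above x.  The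
-- value at k = 0 is a dummy.
_^1/_ : ℝ≥0 → ℕ → ℝ≥0
x ^1/ zero = fromℕ 1
(x ^1/ suc k) .above q = 0ℚ ℚ.< q × (q ^ suc k) ∈ above x
(x ^1/ suc k) .pos = proj₁
(x ^1/ suc k) .inhabited =
  let s , s∈x        = inhabited x
      q , 0<q , s≤q^ = ^-large k s (pos x s∈x)
  in q , 0<q , up-closed x {s} {q ^ suc k} s∈x s≤q^
(x ^1/ suc k) .up-closed {q} {r} (0<q , q^∈x) q≤r =
  ℚ.<-≤-trans 0<q q≤r ,
  up-closed x {q ^ suc k} {r ^ suc k} q^∈x (^-mono-≤ (suc k) q r 0<q q≤r)
(x ^1/ suc k) .rounded {q} (0<q , q^∈x) =
  let s , s∈x , s<q^            = rounded x {q ^ suc k} q^∈x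
      q′ , 0<q′ , q′<q , s<q′^ = ^-shrink (suc k) s q (pos x s∈x) 0<q s<q^
  in q′ , (0<q′ , up-closed x {s} {q′ ^ suc k} s∈x (ℚ.<⇒≤ s<q′^)) , q′<q

_^[_/_] : ℝ≥0 → ℕ → ℕ → ℝ≥0
x ^[ m / k ] = (x ^ℕ m) ^1/ k

{-# OPTIONS --safe #-}

-- Write h = d + 1 and slide a window of length L over [n], through N = L + n
-- positions.  Count the pairs (i, τ) of a position i and a tuple τ of h
-- distinct offsets below L with i - τ_j ∈ A for all j.  For fixed τ the C_h[g]
-- property leaves at most g - 1 positions; for fixed i there are at least
-- (|A ∩ W_i| - d)^h tuples, where W_i is the i-th window.  Hence
-- Σ_i (|A ∩ W_i| - d)^h ≤ (g - 1) L^h, and since Σ_i |A ∩ W_i| = L |A| the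
-- power mean inequality gives (L |A| - d N)^h ≤ N^d (g - 1) L^h.  Choosing
-- L = ⌊n / e⌋ with e = ⌊n^(d/(2h))⌋ makes both error terms O(e).
module Submission where

open import Data.Nat.Base as ℕ using (ℕ; zero; suc; _∸_; z≤n; s≤s)
import Data.Nat.Properties as ℕ
open import Data.Rational.Base as ℚ using (ℚ)
import Data.Rational.Properties as ℚ

module Counting where

  open import Algebra.Properties.Semiring.Sum ℕ.+-*-semiring
  open import Data.Fin.Base using (Fin; zero; suc; toℕ)
  open import Data.Fin.Properties using (suc-injective; toℕ<n)
  open import Data.Nat.Base
  open import Data.Nat.Properties hiding (suc-injective)
  open import Data.Nat.Tactic.RingSolver using (solve-∀)
  open import Data.Product.Base using (∃-syntax; _×_; _,_)
  open import Data.Sum.Base using (inj₁; inj₂)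
  open import Data.Vec.Base using (Vec; []; _∷_; lookup)
  open import Function.Base using (_∘_)
  open import Function.Definitions using (Injective)
  open import Relation.Binary.PropositionalEquality
    using (_≡_; refl; sym; trans; cong; cong₂; subst)
  open import Relation.Nullary using (¬_; contradiction)

  private
    variable
      k m n u : ℕ

  -- Chebyshev's sum inequality and the power mean inequality.

  sum-mono-≤ : {f g : Fin n → ℕ} → (∀ i → f i ≤ g i) → sum f ≤ sum g
  sum-mono-≤ {zero}  f≤g = z≤n
  sum-mono-≤ {suc n} f≤g = +-mono-≤ (f≤g zero) (sum-mono-≤ (f≤g ∘ suc))

  sum-const : ∀ n c → ∑[ i < n ] c ≡ n * c
  sum-const zero    c = refl
  sum-const (suc n) c = cong (c +_) (sum-const n c)

  -- The right side exceeds the left by `(b - a) * (q - p)`. Writing these differences as `c` and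
  -- `e` avoids truncated subtraction.
  rearrangement : ∀ {a b p q} → a ≤ b → p ≤ q → a * q + b * p ≤ a * p + b * q
  rearrangement {a} {p = p} a≤b p≤q
    with c , refl ← m≤n⇒∃[o]m+o≡n a≤b | e , refl ← m≤n⇒∃[o]m+o≡n p≤q =
    ≤-trans (m≤m+n _ (c * e)) (≤-reflexive (identity a c p e))
    where
    identity : ∀ a c p e → a * (p + e) + (a + c) * p + c * e
                         ≡ a * p + (a + c) * (p + e)
    identity = solve-∀

  rearrangement-^ : ∀ k a b → a * b ^ k + b * a ^ k ≤ a * a ^ k + b * b ^ k
  rearrangement-^ k a b with ≤-total a b
  ... | inj₁ a≤b = rearrangement a≤b (^-monoˡ-≤ k a≤b)
  ... | inj₂ b≤a = begin
    a * b ^ k + b * a ^ k  ≡⟨ +-comm (a * b ^ k) _ ⟩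
    b * a ^ k + a * b ^ k  ≤⟨ rearrangement b≤a (^-monoˡ-≤ k b≤a) ⟩
    b * b ^ k + a * a ^ k  ≡⟨ +-comm (b * b ^ k) _ ⟩
    a * a ^ k + b * b ^ k  ∎
    where open ≤-Reasoning

  -- Comonotonicity is assumed for all pairs of indices, so nothing has to be sorted. Induction
  -- splits off the first index, and the hypothesis for the pairs containing it, summed, controls
  -- the cross terms.
  chebyshev-sum : (x y : Fin n → ℕ) →
    (∀ i j → x i * y j + x j * y i ≤ x i * y i + x j * y j) →
    sum x * sum y ≤ n * ∑[ i < n ] (x i * y i)
  chebyshev-sum {zero}  x y comonotone = z≤n
  chebyshev-sum {suc n} x y comonotone = begin
    (x₀ + X) * (y₀ + Y)                      ≡⟨ expand x₀ X y₀ Y ⟩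
    x₀ * y₀ + (x₀ * Y + X * y₀) + X * Y      ≤⟨ +-mono-≤ (+-monoʳ-≤ (x₀ * y₀) cross)
                                                  (chebyshev-sum (x ∘ suc) (y ∘ suc)
                                                    (λ i j → comonotone (suc i) (suc j))) ⟩
    x₀ * y₀ + (n * (x₀ * y₀) + XY) + n * XY  ≡⟨ collect n (x₀ * y₀) XY ⟩
    suc n * (x₀ * y₀ + XY)                   ∎
    where
    open ≤-Reasoning
    x₀ = x zero
    y₀ = y zero
    X  = sum (x ∘ suc)
    Y  = sum (y ∘ suc)
    XY = ∑[ i < n ] (x (suc i) * y (suc i))

    expand : ∀ a b c d → (a + b) * (c + d) ≡ a * c + (a * d + b * c) + b * d
    expand = solve-∀

    collect : ∀ n a b → a + (n * a + b) + n * b ≡ suc n * (a + b)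
    collect = solve-∀

    cross : x₀ * Y + X * y₀ ≤ n * (x₀ * y₀) + XY
    cross = begin
      x₀ * Y + X * y₀
        ≡⟨ cong₂ _+_ (*-distribˡ-sum x₀ (y ∘ suc)) (*-distribʳ-sum y₀ (x ∘ suc)) ⟩
      ∑[ i < n ] (x₀ * y (suc i)) + ∑[ i < n ] (x (suc i) * y₀)
        ≡⟨ ∑-distrib-+ (λ i → x₀ * y (suc i)) (λ i → x (suc i) * y₀) ⟨
      ∑[ i < n ] (x₀ * y (suc i) + x (suc i) * y₀)
        ≤⟨ sum-mono-≤ (λ i → comonotone zero (suc i)) ⟩
      ∑[ i < n ] (x₀ * y₀ + x (suc i) * y (suc i))
        ≡⟨ ∑-distrib-+ (λ _ → x₀ * y₀) (λ i → x (suc i) * y (suc i)) ⟩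
      ∑[ i < n ] (x₀ * y₀) + XY
        ≡⟨ cong (_+ XY) (sum-const n (x₀ * y₀)) ⟩
      n * (x₀ * y₀) + XY ∎

  -- Each induction step is Chebyshev's inequality for `x` and its power `x ^ suc k`, which are
  -- ordered alike.
  power-mean : ∀ k (x : Fin n → ℕ) →
    sum x ^ suc k ≤ n ^ k * ∑[ i < n ] (x i ^ suc k)
  power-mean {n} zero x = ≤-reflexive (trans (*-identityʳ (sum x))
    (trans (sum-cong-≗ (λ i → sym (*-identityʳ (x i))))
      (sym (+-identityʳ (∑[ i < n ] (x i ^ 1))))))
  power-mean {n} (suc k) x = begin
    sum x * sum x ^ suc k      ≤⟨ *-monoʳ-≤ (sum x) (power-mean k x) ⟩
    sum x * (n ^ k * S)        ≡⟨ swap (sum x) (n ^ k) S ⟩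
    n ^ k * (sum x * S)        ≤⟨ *-monoʳ-≤ (n ^ k) (chebyshev-sum x (λ i → x i ^ suc k)
                                    (λ i j → rearrangement-^ (suc k) (x i) (x j))) ⟩
    n ^ k * (n * ∑[ i < n ] (x i ^ suc (suc k)))
                               ≡⟨ assoc (n ^ k) n _ ⟩
    n ^ suc k * ∑[ i < n ] (x i ^ suc (suc k)) ∎
    where
    open ≤-Reasoning
    S = ∑[ i < n ] (x i ^ suc k)
    swap : ∀ a b c → a * (b * c) ≡ b * (a * c)
    swap = solve-∀
    assoc : ∀ a b c → a * (b * c) ≡ b * a * c
    assoc = solve-∀

  -- Sums over tuples.

  ∑Vec : ∀ k → (Vec (Fin u) k → ℕ) → ℕ
  ∑Vec     zero    F = F []
  ∑Vec {u} (suc k) F = ∑Vec k λ τ → ∑[ t < u ] F (t ∷ τ)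

  ∑Vec-mono-≤ : ∀ k {F G : Vec (Fin u) k → ℕ} → (∀ τ → F τ ≤ G τ) →
                ∑Vec k F ≤ ∑Vec k G
  ∑Vec-mono-≤ zero    F≤G = F≤G []
  ∑Vec-mono-≤ (suc k) F≤G = ∑Vec-mono-≤ k λ τ → sum-mono-≤ λ t → F≤G (t ∷ τ)

  ∑Vec-cong : ∀ k {F G : Vec (Fin u) k → ℕ} → (∀ τ → F τ ≡ G τ) →
              ∑Vec k F ≡ ∑Vec k G
  ∑Vec-cong zero    F≡G = F≡G []
  ∑Vec-cong (suc k) F≡G = ∑Vec-cong k λ τ → sum-cong-≗ λ t → F≡G (t ∷ τ)

  *-distribˡ-∑Vec : ∀ k c (F : Vec (Fin u) k → ℕ) →
                    c * ∑Vec k F ≡ ∑Vec k (λ τ → c * F τ)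
  *-distribˡ-∑Vec zero    c F = refl
  *-distribˡ-∑Vec (suc k) c F = trans (*-distribˡ-∑Vec k c _)
    (∑Vec-cong k λ τ → *-distribˡ-sum c (λ t → F (t ∷ τ)))

  ∑Vec-const : ∀ k c → ∑Vec {u} k (λ _ → c) ≡ c * u ^ k
  ∑Vec-const     zero    c = sym (*-identityʳ c)
  ∑Vec-const {u} (suc k) c = trans (∑Vec-const k (∑[ t < u ] c))
    (trans (cong (_* u ^ k) (trans (sum-const u c) (*-comm u c))) (*-assoc c u (u ^ k)))

  ∑-∑Vec-comm : ∀ k (F : Fin n → Vec (Fin u) k → ℕ) →
    ∑[ i < n ] ∑Vec k (F i) ≡ ∑Vec k λ τ → ∑[ i < n ] F i τ
  ∑-∑Vec-comm zero    F = refl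
  ∑-∑Vec-comm {n} {u} (suc k) F =
    trans (∑-∑Vec-comm {n} k λ i τ → ∑[ t < u ] F i (t ∷ τ))
      (∑Vec-cong k λ τ → ∑-comm {n} {u} λ i t → F i (t ∷ τ))

  -- Counting tuples of distinct entries.

  differs : Fin n → Fin n → ℕ
  differs zero    zero    = 0
  differs zero    (suc t) = 1
  differs (suc s) zero    = 1
  differs (suc s) (suc t) = differs s t

  -- Conditions on tuples are encoded by the values 0 and 1, so that conjunction is a product and
  -- counting is a sum.
  fresh : Vec (Fin u) k → Fin u → ℕ
  fresh []      t = 1
  fresh (s ∷ τ) t = differs s t * fresh τ t

  distinct : Vec (Fin u) k → ℕ
  distinct []      = 1
  distinct (t ∷ τ) = fresh τ t * distinct τ

  hits : (Fin u → ℕ) → Vec (Fin u) k → ℕ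
  hits f []      = 1
  hits f (t ∷ τ) = f t * hits f τ

  differs≤1 : (s t : Fin n) → differs s t ≤ 1
  differs≤1 zero    zero    = z≤n
  differs≤1 zero    (suc t) = ≤-refl
  differs≤1 (suc s) zero    = ≤-refl
  differs≤1 (suc s) (suc t) = differs≤1 s t

  fresh≤1 : (τ : Vec (Fin u) k) → ∀ t → fresh τ t ≤ 1
  fresh≤1 []      t = ≤-refl
  fresh≤1 (s ∷ τ) t = *-mono-≤ (differs≤1 s t) (fresh≤1 τ t)

  distinct≤1 : (τ : Vec (Fin u) k) → distinct τ ≤ 1
  distinct≤1 []      = ≤-refl
  distinct≤1 (t ∷ τ) = *-mono-≤ (fresh≤1 τ t) (distinct≤1 τ)

  hits≤1 : {f : Fin u → ℕ} → (∀ t → f t ≤ 1) → (τ : Vec (Fin u) k) → hits f τ ≤ 1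
  hits≤1 f≤1 []      = ≤-refl
  hits≤1 f≤1 (t ∷ τ) = *-mono-≤ (f≤1 t) (hits≤1 f≤1 τ)

  0<m*n⇒0<m : ∀ m {n} → 0 < m * n → 0 < m
  0<m*n⇒0<m (suc m) _ = z<s

  0<m*n⇒0<n : ∀ m {n} → 0 < m * n → 0 < n
  0<m*n⇒0<n m {n} 0<mn = 0<m*n⇒0<m n (subst (0 <_) (*-comm m n) 0<mn)

  differs-irrefl : (t : Fin n) → ¬ 0 < differs t t
  differs-irrefl zero    ()
  differs-irrefl (suc t) = differs-irrefl t

  fresh⇒≢ : (τ : Vec (Fin u) k) → ∀ t j → 0 < fresh τ t → ¬ lookup τ j ≡ t
  fresh⇒≢ (s ∷ τ) t zero    0<fr refl = differs-irrefl s (0<m*n⇒0<m (differs s s) 0<fr)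
  fresh⇒≢ (s ∷ τ) t (suc j) 0<fr      = fresh⇒≢ τ t j (0<m*n⇒0<n (differs s t) 0<fr)

  distinct⇒injective : (τ : Vec (Fin u) k) → 0 < distinct τ → Injective _≡_ _≡_ (lookup τ)
  distinct⇒injective (t ∷ τ) 0<d {zero}  {zero}  eq = refl
  distinct⇒injective (t ∷ τ) 0<d {zero}  {suc j} eq =
    contradiction (sym eq) (fresh⇒≢ τ t j (0<m*n⇒0<m (fresh τ t) 0<d))
  distinct⇒injective (t ∷ τ) 0<d {suc i} {zero}  eq =
    contradiction eq (fresh⇒≢ τ t i (0<m*n⇒0<m (fresh τ t) 0<d))
  distinct⇒injective (t ∷ τ) 0<d {suc i} {suc j} eq =
    cong suc (distinct⇒injective τ (0<m*n⇒0<n (fresh τ t) 0<d) eq)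

  hits⇒pos : (f : Fin u → ℕ) (τ : Vec (Fin u) k) → 0 < hits f τ →
             ∀ j → 0 < f (lookup τ j)
  hits⇒pos f (t ∷ τ) 0<h zero    = 0<m*n⇒0<m (f t) 0<h
  hits⇒pos f (t ∷ τ) 0<h (suc j) = hits⇒pos f τ (0<m*n⇒0<n (f t) 0<h) j

  sum-differs : (s : Fin n) (f : Fin n → ℕ) → (∀ t → f t ≤ 1) →
                sum f ≤ ∑[ t < n ] (differs s t * f t) + 1
  sum-differs {suc n} zero f f≤1 = begin
    f zero + sum (f ∘ suc)                  ≤⟨ +-monoˡ-≤ _ (f≤1 zero) ⟩
    1 + sum (f ∘ suc)                       ≡⟨ +-comm 1 _ ⟩
    sum (f ∘ suc) + 1                       ≡⟨ cong (_+ 1) (sum-cong-≗ (λ t → +-identityʳ (f (suc t)))) ⟨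
    ∑[ t < n ] (1 * f (suc t)) + 1          ∎
    where open ≤-Reasoning
  sum-differs {suc n} (suc s) f f≤1 = begin
    f zero + sum (f ∘ suc)            ≤⟨ +-mono-≤ (≤-reflexive (sym (+-identityʳ (f zero))))
                                           (sum-differs s (f ∘ suc) (f≤1 ∘ suc)) ⟩
    1 * f zero + (S + 1)              ≡⟨ +-assoc (1 * f zero) S 1 ⟨
    1 * f zero + S + 1                ∎
    where
    open ≤-Reasoning
    S = ∑[ t < n ] (differs s t * f (suc t))

  -- Each of the `k` entries of `τ` deletes a single summand, and a summand is at most 1.
  sum-fresh : (f : Fin u → ℕ) → (∀ t → f t ≤ 1) → (τ : Vec (Fin u) k) →
              sum f ≤ ∑[ t < u ] (fresh τ t * f t) + k
  sum-fresh f f≤1 [] = ≤-reflexive (sym (trans (+-identityʳ _)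
    (sum-cong-≗ (λ t → +-identityʳ (f t)))))
  sum-fresh {u} {suc k} f f≤1 (s ∷ τ) = begin
    sum f
      ≤⟨ sum-fresh f f≤1 τ ⟩
    ∑[ t < u ] (fresh τ t * f t) + k
      ≤⟨ +-monoˡ-≤ k (sum-differs s _ (λ t → *-mono-≤ (fresh≤1 τ t) (f≤1 t))) ⟩
    ∑[ t < u ] (differs s t * (fresh τ t * f t)) + 1 + k
      ≡⟨ +-assoc _ 1 k ⟩
    ∑[ t < u ] (differs s t * (fresh τ t * f t)) + suc k
      ≡⟨ cong (_+ suc k) (sum-cong-≗ (λ t → *-assoc (differs s t) (fresh τ t) (f t))) ⟨
    ∑[ t < u ] (fresh (s ∷ τ) t * f t) + suc k ∎
    where open ≤-Reasoning

  -- For the indicator `f` of a set of size S the right side is the falling factorial S (S - 1) ...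
  -- (S - k + 1). As `k ≤ suc d`, every factor is at least S - d.
  ∑Vec-distinct-hits : ∀ d (f : Fin u → ℕ) → (∀ t → f t ≤ 1) → ∀ k → k ≤ suc d →
    (sum f ∸ d) ^ k ≤ ∑Vec k λ τ → distinct τ * hits f τ
  ∑Vec-distinct-hits d f f≤1 zero _ = ≤-refl
  ∑Vec-distinct-hits {u} d f f≤1 (suc k) (s≤s k≤d) = begin
    c * c ^ k
      ≤⟨ *-monoʳ-≤ c (∑Vec-distinct-hits d f f≤1 k (m≤n⇒m≤1+n k≤d)) ⟩
    c * ∑Vec k D
      ≡⟨ *-distribˡ-∑Vec k c D ⟩
    ∑Vec k (λ τ → c * D τ)
      -- For a fixed tail `τ` at least `c` heads are both hits and new.
      ≤⟨ ∑Vec-mono-≤ k (λ τ → *-monoˡ-≤ (D τ) (c≤ τ)) ⟩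
    ∑Vec k (λ τ → ∑[ t < u ] (fresh τ t * f t) * D τ)
      ≡⟨ ∑Vec-cong k (λ τ → trans (*-distribʳ-sum (D τ) (λ t → fresh τ t * f t))
           (sum-cong-≗ (λ t → regroup (fresh τ t) (f t) (distinct τ) (hits f τ)))) ⟩
    ∑Vec (suc k) (λ τ → distinct τ * hits f τ) ∎
    where
    open ≤-Reasoning
    c = sum f ∸ d
    D : Vec (Fin u) k → ℕ
    D τ = distinct τ * hits f τ
    c≤ : ∀ τ → c ≤ ∑[ t < u ] (fresh τ t * f t)
    c≤ τ = m≤n+o⇒m∸n≤o _ d (≤-trans (sum-fresh f f≤1 τ)
      (≤-trans (+-monoʳ-≤ _ k≤d) (≤-reflexive (+-comm _ d))))
    regroup : ∀ a b c d → a * b * (c * d) ≡ a * c * (b * d)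
    regroup = solve-∀

  -- Converts a count into the injective enumeration that the definition of a C_h[g]-set quantifies
  -- over, by scanning for the first `g` positions of value 1.
  choose : ∀ g (p : Fin n → ℕ) → (∀ i → p i ≤ 1) → g ≤ sum p →
           ∃[ κ ] (Injective {A = Fin g} _≡_ _≡_ κ × (∀ i → 0 < p (κ i)))
  choose {zero} zero p p≤1 _ = (λ ()) , (λ { {()} }) , λ ()
  choose {suc n} g p p≤1 g≤ with p zero in eq
  ... | zero with κ , inj , pos ← choose g (p ∘ suc) (p≤1 ∘ suc) g≤ =
    suc ∘ κ , inj ∘ suc-injective , pos
  choose {suc n} zero p p≤1 g≤ | suc _ = (λ ()) , (λ { {()} }) , λ ()
  choose {suc n} (suc g) p p≤1 g≤ | suc c
    -- Since `p zero` is at most 1, the remaining sum is still at least `g`.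
    with κ , inj , pos ← choose g (p ∘ suc) (p≤1 ∘ suc)
      (s≤s⁻¹ (≤-trans g≤ (+-monoˡ-≤ _ (subst (_≤ 1) eq (p≤1 zero))))) =
    κ′ , inj′ , pos′
    where
    κ′ : Fin (suc g) → Fin (suc n)
    κ′ zero    = zero
    κ′ (suc i) = suc (κ i)
    inj′ : Injective _≡_ _≡_ κ′
    inj′ {zero}  {zero}  _  = refl
    inj′ {suc i} {suc j} eq = cong suc (inj (suc-injective eq))
    pos′ : ∀ i → 0 < p (κ′ i)
    pos′ zero    = subst (0 <_) (sym eq) z<s
    pos′ (suc i) = pos i

  -- Shifts and the double count over windows.

  -- i ↦ f (i - t), extended by zero.
  shift : ℕ → (ℕ → ℕ) → ℕ → ℕ
  shift zero    f i       = f i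
  shift (suc t) f zero    = 0
  shift (suc t) f (suc i) = shift t f i

  shift≤1 : ∀ {f} → (∀ i → f i ≤ 1) → ∀ t i → shift t f i ≤ 1
  shift≤1 f≤1 zero    i       = f≤1 i
  shift≤1 f≤1 (suc t) zero    = z≤n
  shift≤1 f≤1 (suc t) (suc i) = shift≤1 f≤1 t i

  shift-pos : ∀ {f} t i → 0 < shift t f i → ∃[ j ] (i ≡ t + j × 0 < f j)
  shift-pos zero    i       0<f = i , refl , 0<f
  shift-pos (suc t) (suc i) 0<f with j , eq , 0<fj ← shift-pos t i 0<f =
    j , cong suc eq , 0<fj

  sum-extend : (f : ℕ → ℕ) → m ≤ n → ∑[ i < m ] f (toℕ i) ≤ ∑[ i < n ] f (toℕ i)
  sum-extend f z≤n       = z≤n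
  sum-extend f (s≤s m≤n) = +-monoʳ-≤ (f 0) (sum-extend (f ∘ suc) m≤n)

  -- Nothing is lost: a shift by at most `u` keeps the positions below `n` inside the first `u + n`.
  sum-shift : (f : ℕ → ℕ) → ∀ {t} → t ≤ u →
    ∑[ i < n ] f (toℕ i) ≤ ∑[ i < u + n ] shift t f (toℕ i)
  sum-shift {u} {n} f z≤n       = sum-extend f (m≤n+m n u)
  sum-shift         f (s≤s t≤u) = sum-shift f t≤u

  -- Here and below the parameter g is one less than the g of C_h[g].
  module _ (d g u n : ℕ) (f : ℕ → ℕ) (f≤1 : ∀ i → f i ≤ 1)
    (noPattern : (τ : Fin (suc d) → Fin u) → Injective _≡_ _≡_ τ →
      (κ : Fin (suc g) → Fin (u + n)) → Injective _≡_ _≡_ κ →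
      ¬ (∀ i j → 0 < shift (toℕ (τ j)) f (toℕ (κ i))))
    where

    window : ℕ → Fin u → ℕ
    window i t = shift (toℕ t) f i

    -- If more than `g` positions carried `τ`, `choose` would produce `suc g` of them, against
    -- `noPattern`.
    patterns : ∀ τ → ∑[ i < u + n ] (distinct τ * hits {k = suc d} (window (toℕ i)) τ) ≤ g
    patterns τ = ≮⇒≥ λ g<sum →
      let κ , inj , pos = choose (suc g) _
            (λ i → *-mono-≤ (distinct≤1 τ) (hits≤1 (λ t → shift≤1 f≤1 (toℕ t) (toℕ i)) τ)) g<sum
      in noPattern (lookup τ)
           -- `distinct τ` is a factor of every summand, so a single chosen position, here `zero`,
           -- already shows that `τ` is injective.
           (distinct⇒injective τ (0<m*n⇒0<m (distinct τ) (pos zero))) κ inj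
           λ i j → hits⇒pos (window (toℕ (κ i))) τ (0<m*n⇒0<n (distinct τ) (pos i)) j

    -- Both sides estimate the number of pairs of a position and a tuple: from below with the
    -- position fixed, from above with the tuple fixed.
    sum-windows : ∑[ i < u + n ] ((sum (window (toℕ i)) ∸ d) ^ suc d) ≤ g * u ^ suc d
    sum-windows = begin
      ∑[ i < u + n ] ((sum (window (toℕ i)) ∸ d) ^ suc d)
        ≤⟨ sum-mono-≤ {u + n} (λ i → ∑Vec-distinct-hits d (window (toℕ i))
             (λ t → shift≤1 f≤1 (toℕ t) (toℕ i)) (suc d) ≤-refl) ⟩
      ∑[ i < u + n ] ∑Vec (suc d) (F i)
        ≡⟨ ∑-∑Vec-comm {u + n} (suc d) F ⟩
      ∑Vec (suc d) (λ τ → ∑[ i < u + n ] F i τ)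
        ≤⟨ ∑Vec-mono-≤ (suc d) patterns ⟩
      ∑Vec {u} (suc d) (λ _ → g)
        ≡⟨ ∑Vec-const (suc d) g ⟩
      g * u ^ suc d ∎
      where
      open ≤-Reasoning
      F : Fin (u + n) → Vec (Fin u) (suc d) → ℕ
      F i τ = distinct τ * hits (window (toℕ i)) τ

    window-bound : (u * ∑[ i < n ] f (toℕ i) ∸ (u + n) * d) ^ suc d
                   ≤ (u + n) ^ d * (g * u ^ suc d)
    window-bound = begin
      (u * M ∸ N * d) ^ suc d
        ≤⟨ ^-monoˡ-≤ (suc d) (m≤n+o⇒m∸n≤o _ (N * d) total) ⟩
      (∑[ i < N ] (W i ∸ d)) ^ suc d
        ≤⟨ power-mean d (λ (i : Fin N) → W i ∸ d) ⟩
      N ^ d * ∑[ i < N ] ((W i ∸ d) ^ suc d)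
        ≤⟨ *-monoʳ-≤ (N ^ d) sum-windows ⟩
      N ^ d * (g * u ^ suc d) ∎
      where
      open ≤-Reasoning
      M = ∑[ i < n ] f (toℕ i)
      N = u + n
      W : Fin N → ℕ
      W i = sum (window (toℕ i))
      -- Each offset `t` contributes a full copy of `M`, and subtracting `d` costs at most `d` in
      -- each of the `N` windows.
      total : u * M ≤ N * d + ∑[ i < N ] (W i ∸ d)
      total = begin
        u * M
          ≡⟨ sum-const u M ⟨
        ∑[ t < u ] M
          ≤⟨ sum-mono-≤ {u} (λ t → sum-shift {u} {n} f (<⇒≤ (toℕ<n t))) ⟩
        ∑[ t < u ] ∑[ i < N ] shift (toℕ t) f (toℕ i)
          ≡⟨ ∑-comm {u} {N} (λ t i → shift (toℕ t) f (toℕ i)) ⟩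
        ∑[ i < N ] W i
          ≤⟨ sum-mono-≤ {N} (λ i → m≤n+m∸n (W i) d) ⟩
        ∑[ i < N ] (d + (W i ∸ d))
          ≡⟨ ∑-distrib-+ {N} (λ _ → d) (λ i → W i ∸ d) ⟩
        ∑[ i < N ] d + ∑[ i < N ] (W i ∸ d)
          ≡⟨ cong (_+ ∑[ i < N ] (W i ∸ d)) (sum-const N d) ⟩
        N * d + ∑[ i < N ] (W i ∸ d) ∎

-- Integer roots and powers.

module Powers where

  open import Data.Nat.Base
  open import Data.Nat.Properties
  open import Data.Nat.Tactic.RingSolver using (solve-∀)
  open import Data.Product.Base using (∃-syntax; _×_; _,_)
  open import Relation.Binary.PropositionalEquality using (_≡_; refl; trans; cong)
  open import Relation.Nullary using (yes; no)

  -- Recursion on `x`: when `x` grows by 1, the root grows by at most 1.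
  floorRoot : ∀ k .{{_ : NonZero k}} x → ∃[ e ] (e ^ k ≤ x × x < suc e ^ k)
  floorRoot (suc k) zero = 0 , z≤n , m^n>0 1 (suc k)
  floorRoot k (suc x) with e , e^k≤x , x<e⁺^k ← floorRoot k x with suc x <? suc e ^ k
  ... | yes x⁺<e⁺^k = e , m≤n⇒m≤1+n e^k≤x , x⁺<e⁺^k
  ... | no  x⁺≮e⁺^k = suc e , ≮⇒≥ x⁺≮e⁺^k ,
    ≤-<-trans x<e⁺^k (^-monoˡ-< k (n<1+n (suc e)))

  ^-cancelˡ-≤ : ∀ k .{{_ : NonZero k}} {m n} → m ^ k ≤ n ^ k → m ≤ n
  ^-cancelˡ-≤ k m^k≤n^k = ≮⇒≥ λ n<m → <⇒≱ (^-monoˡ-< k n<m) m^k≤n^k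

  ^-distribʳ-* : ∀ k m n → (m * n) ^ k ≡ m ^ k * n ^ k
  ^-distribʳ-* zero    m n = refl
  ^-distribʳ-* (suc k) m n = trans (cong (m * n *_) (^-distribʳ-* k m n))
    (interchange m n (m ^ k) (n ^ k))
    where
    interchange : ∀ a b c d → a * b * (c * d) ≡ a * c * (b * d)
    interchange = solve-∀

-- The naturals inside the rationals, and monotonicity of rational powers.

module Rationals where

  open import Algebra.Bundles using (CommutativeRing)
  open import Algebra.Definitions.RawSemiring ℚ.+-*-rawSemiring public using (_^_)
  open import Algebra.Properties.CommutativeSemiring.Exp
    (CommutativeRing.commutativeSemiring ℚ.+-*-commutativeRing) using (^-distrib-*) public
  open import Data.Integer.Base as ℤ using (+_)
  import Data.Integer.Properties as ℤ
  open import Data.Rational.Literals using (fromℤ)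
  open import Data.Rational.Base
  open import Data.Rational.Properties
  open import Relation.Binary.PropositionalEquality
    using (_≡_; refl; sym; trans; cong; cong₂; subst; subst₂)

  -- This is the form used in `fromℕ`, so membership of `q` in that cut is `ι m < q` by definition.
  ι : ℕ → ℚ
  ι m = + m / 1

  -- `_/_` divides by a gcd that does not reduce for a variable `m`; `fromℤ` is already in lowest
  -- terms, so arithmetic on it computes.
  ι≡fromℤ : ∀ m → ι m ≡ fromℤ (+ m)
  ι≡fromℤ m = ↥p/↧p≡p (fromℤ (+ m))

  ι-+ : ∀ m n → ι (m ℕ.+ n) ≡ ι m + ι n
  ι-+ m n = trans
    (cong (_/ 1) (sym (cong₂ ℤ._+_ (ℤ.*-identityʳ (+ m)) (ℤ.*-identityʳ (+ n)))))
    (sym (cong₂ _+_ (ι≡fromℤ m) (ι≡fromℤ n)))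

  ι-* : ∀ m n → ι (m ℕ.* n) ≡ ι m * ι n
  ι-* m n = trans (cong (_/ 1) (ℤ.pos-* m n))
    (sym (cong₂ _*_ (ι≡fromℤ m) (ι≡fromℤ n)))

  ι-^ : ∀ m k → ι (m ℕ.^ k) ≡ ι m ^ k
  ι-^ m zero    = refl
  ι-^ m (suc k) = trans (ι-* m (m ℕ.^ k)) (cong (ι m *_) (ι-^ m k))

  ι-mono-≤ : ∀ {m n} → m ℕ.≤ n → ι m ≤ ι n
  ι-mono-≤ {m} {n} m≤n = subst₂ _≤_ (sym (ι≡fromℤ m)) (sym (ι≡fromℤ n))
    (*≤* (ℤ.*-monoʳ-≤-nonNeg (+ 1) (ℤ.+≤+ m≤n)))

  0≤ι : ∀ m → 0ℚ ≤ ι m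
  0≤ι m = ι-mono-≤ {0} {m} z≤n

  0<ι : ∀ m .{{_ : ℕ.NonZero m}} → 0ℚ < ι m
  0<ι (suc m) = <-≤-trans (positive⁻¹ 1ℚ) (ι-mono-≤ {1} {suc m} (s≤s z≤n))

  *-monoˡ : ∀ {p q r} → 0ℚ ≤ r → p ≤ q → p * r ≤ q * r
  *-monoˡ {r = r} 0≤r = *-monoʳ-≤-nonNeg r {{nonNegative 0≤r}}

  *-monoʳ : ∀ {p q r} → 0ℚ ≤ r → p ≤ q → r * p ≤ r * q
  *-monoʳ {r = r} 0≤r = *-monoˡ-≤-nonNeg r {{nonNegative 0≤r}}

  *-monoˡ-< : ∀ {p q r} → 0ℚ < r → p < q → p * r < q * r
  *-monoˡ-< {r = r} 0<r = *-monoˡ-<-pos r {{positive 0<r}}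

  *-nonNeg : ∀ {p q} → 0ℚ ≤ p → 0ℚ ≤ q → 0ℚ ≤ p * q
  *-nonNeg {p} {q} 0≤p 0≤q = subst (_≤ p * q) (*-zeroʳ p) (*-monoʳ 0≤p 0≤q)

  ^-nonNeg : ∀ k {p} → 0ℚ ≤ p → 0ℚ ≤ p ^ k
  ^-nonNeg zero    0≤p = 0≤ι 1
  ^-nonNeg (suc k) 0≤p = *-nonNeg 0≤p (^-nonNeg k 0≤p)

  ^-mono-≤ : ∀ k {p q} → 0ℚ ≤ p → p ≤ q → p ^ k ≤ q ^ k
  ^-mono-≤ zero    0≤p p≤q = ≤-refl
  ^-mono-≤ (suc k) 0≤p p≤q = ≤-trans (*-monoʳ 0≤p (^-mono-≤ k 0≤p p≤q))
    (*-monoˡ (^-nonNeg k (≤-trans 0≤p p≤q)) p≤q)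

  ^-pos : ∀ k {p} → 0ℚ < p → 0ℚ < p ^ k
  ^-pos zero        0<p = positive⁻¹ 1ℚ
  ^-pos (suc k) {p} 0<p = subst (_< p * p ^ k) (*-zeroˡ (p ^ k))
    (*-monoˡ-< (^-pos k 0<p) 0<p)

  ^-mono-< : ∀ k {p q} → 0ℚ ≤ p → p < q → p ^ suc k < q ^ suc k
  ^-mono-< k 0≤p p<q = ≤-<-trans (*-monoʳ 0≤p (^-mono-≤ k 0≤p (<⇒≤ p<q)))
    (*-monoˡ-< (^-pos k (≤-<-trans 0≤p p<q)) p<q)

  ^-cancel-≤ : ∀ k {p q} → 0ℚ ≤ q → p ^ suc k ≤ q ^ suc k → p ≤ q
  ^-cancel-≤ k 0≤q p^≤q^ = ≮⇒≥ λ q<p → <-irrefl refl (<-≤-trans (^-mono-< k 0≤q q<p) p^≤q^)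

  ^-cancel-< : ∀ k {p q} → 0ℚ ≤ q → p ^ k < q ^ k → p < q
  ^-cancel-< k 0≤q p^<q^ = ≰⇒> λ q≤p → <-irrefl refl (<-≤-trans p^<q^ (^-mono-≤ k 0≤q q≤p))

-- Extracting the error term from the window inequality.

module Estimate (d g n L e m : ℕ) .{{_ : ℕ.NonZero n}} .{{_ : ℕ.NonZero L}} .{{_ : ℕ.NonZero e}}
  (windows : (L ℕ.* m ∸ (L ℕ.+ n) ℕ.* d) ℕ.^ suc d ℕ.≤ (L ℕ.+ n) ℕ.^ d ℕ.* (g ℕ.* L ℕ.^ suc d))
  (Le≤n : L ℕ.* e ℕ.≤ n) (n≤2Le : n ℕ.≤ 2 ℕ.* (L ℕ.* e))
  where

  open import Data.Nat.Tactic.RingSolver using (solve-∀)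
  open import Data.Rational.Base
  open import Data.Rational.Properties
  open import Relation.Binary.PropositionalEquality
    using (_≡_; trans; cong)
  open Powers
  open Rationals

  N M : ℕ
  N = L ℕ.+ n
  M = L ℕ.* m ∸ N ℕ.* d

  -- `windows` multiplied by `n ^ suc d`, with one factor `n` raised to `N`. Taking h-th roots gives
  -- M ≤ (g n^d)^(1/h) N L / n, kept free of division.
  power-boundℕ : (M ℕ.* n) ℕ.^ suc d ℕ.≤ (g ℕ.* n ℕ.^ d) ℕ.* (N ℕ.* L) ℕ.^ suc d
  power-boundℕ = begin
    (M ℕ.* n) ℕ.^ suc d
      ≡⟨ ^-distribʳ-* (suc d) M n ⟩
    M ℕ.^ suc d ℕ.* (n ℕ.* n ℕ.^ d)
      ≤⟨ ℕ.*-mono-≤ windows (ℕ.*-monoˡ-≤ (n ℕ.^ d) (ℕ.m≤n+m n L)) ⟩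
    N ℕ.^ d ℕ.* (g ℕ.* L ℕ.^ suc d) ℕ.* (N ℕ.* n ℕ.^ d)
      ≡⟨ regroup (N ℕ.^ d) g (L ℕ.^ suc d) N (n ℕ.^ d) ⟩
    g ℕ.* n ℕ.^ d ℕ.* (N ℕ.^ suc d ℕ.* L ℕ.^ suc d)
      ≡⟨ cong (g ℕ.* n ℕ.^ d ℕ.*_) (^-distribʳ-* (suc d) N L) ⟨
    g ℕ.* n ℕ.^ d ℕ.* (N ℕ.* L) ℕ.^ suc d ∎
    where
    open ℕ.≤-Reasoning
    regroup : ∀ a b c x y → a ℕ.* (b ℕ.* c) ℕ.* (x ℕ.* y) ≡ b ℕ.* y ℕ.* (x ℕ.* a ℕ.* c)
    regroup = solve-∀

  -- After division by `L * n`: the loss `N * d` in `M` costs at most `4 * d * e`, because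
  -- `N ≤ 4 * (L * e)`.
  length-boundℕ : m ℕ.* (L ℕ.* n) ℕ.≤ M ℕ.* n ℕ.+ 4 ℕ.* d ℕ.* e ℕ.* (L ℕ.* n)
  length-boundℕ = begin
    m ℕ.* (L ℕ.* n)
      ≡⟨ regroup₁ m L n ⟩
    L ℕ.* m ℕ.* n
      ≤⟨ ℕ.*-monoˡ-≤ n (ℕ.m≤n+m∸n (L ℕ.* m) (N ℕ.* d)) ⟩
    (N ℕ.* d ℕ.+ M) ℕ.* n
      ≡⟨ regroup₂ N d M n ⟩
    M ℕ.* n ℕ.+ N ℕ.* (d ℕ.* n)
      ≤⟨ ℕ.+-monoʳ-≤ (M ℕ.* n) (ℕ.*-monoˡ-≤ (d ℕ.* n) N≤4Le) ⟩
    M ℕ.* n ℕ.+ 4 ℕ.* (L ℕ.* e) ℕ.* (d ℕ.* n)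
      ≡⟨ regroup₃ (M ℕ.* n) L e d n ⟩
    M ℕ.* n ℕ.+ 4 ℕ.* d ℕ.* e ℕ.* (L ℕ.* n) ∎
    where
    open ℕ.≤-Reasoning
    regroup₁ : ∀ m L n → m ℕ.* (L ℕ.* n) ≡ L ℕ.* m ℕ.* n
    regroup₁ = solve-∀
    regroup₂ : ∀ N d M n → (N ℕ.* d ℕ.+ M) ℕ.* n ≡ M ℕ.* n ℕ.+ N ℕ.* (d ℕ.* n)
    regroup₂ = solve-∀
    regroup₃ : ∀ x L e d n → x ℕ.+ 4 ℕ.* (L ℕ.* e) ℕ.* (d ℕ.* n) ≡ x ℕ.+ 4 ℕ.* d ℕ.* e ℕ.* (L ℕ.* n)
    regroup₃ = solve-∀
    N≤4Le : N ℕ.≤ 4 ℕ.* (L ℕ.* e)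
    N≤4Le = begin
      L ℕ.+ n                        ≤⟨ ℕ.+-monoˡ-≤ n (ℕ.≤-trans (ℕ.m≤m*n L e) Le≤n) ⟩
      n ℕ.+ n                        ≤⟨ ℕ.+-mono-≤ n≤2Le n≤2Le ⟩
      2 ℕ.* (L ℕ.* e) ℕ.+ 2 ℕ.* (L ℕ.* e)  ≡⟨ double (L ℕ.* e) ⟩
      4 ℕ.* (L ℕ.* e)                ∎
      where
      double : ∀ x → 2 ℕ.* x ℕ.+ 2 ℕ.* x ≡ 4 ℕ.* x
      double = solve-∀

  -- For s ≤ K (2e)^2 this bounds the error s L / n by 4 K e, using `L * e ≤ n`.
  square-boundℕ : ∀ K → K ℕ.* (2 ℕ.* e ℕ.* (2 ℕ.* e)) ℕ.* (L ℕ.* L) ℕ.≤ 4 ℕ.* K ℕ.* e ℕ.* (L ℕ.* n)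
  square-boundℕ K = begin
    K ℕ.* (2 ℕ.* e ℕ.* (2 ℕ.* e)) ℕ.* (L ℕ.* L)  ≡⟨ regroup₁ K e L ⟩
    4 ℕ.* K ℕ.* e ℕ.* L ℕ.* (L ℕ.* e)            ≤⟨ ℕ.*-monoʳ-≤ (4 ℕ.* K ℕ.* e ℕ.* L) Le≤n ⟩
    4 ℕ.* K ℕ.* e ℕ.* L ℕ.* n                    ≡⟨ ℕ.*-assoc (4 ℕ.* K ℕ.* e) L n ⟩
    4 ℕ.* K ℕ.* e ℕ.* (L ℕ.* n)                  ∎
    where
    open ℕ.≤-Reasoning
    regroup₁ : ∀ K e L → K ℕ.* (2 ℕ.* e ℕ.* (2 ℕ.* e)) ℕ.* (L ℕ.* L) ≡ 4 ℕ.* K ℕ.* e ℕ.* L ℕ.* (L ℕ.* e)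
    regroup₁ = solve-∀

  module _ (K : ℕ) {s : ℚ} (0≤s : 0ℚ ≤ s) (gn^d≤s^h : ι (g ℕ.* n ℕ.^ d) ≤ s ^ suc d) where

    root-bound : ι (M ℕ.* n) ≤ s * ι (N ℕ.* L)
    root-bound = ^-cancel-≤ d (*-nonNeg 0≤s (0≤ι (N ℕ.* L))) (begin
      ι (M ℕ.* n) ^ suc d
        ≡⟨ ι-^ (M ℕ.* n) (suc d) ⟨
      ι ((M ℕ.* n) ℕ.^ suc d)
        ≤⟨ ι-mono-≤ power-boundℕ ⟩
      ι (g ℕ.* n ℕ.^ d ℕ.* (N ℕ.* L) ℕ.^ suc d)
        ≡⟨ ι-* (g ℕ.* n ℕ.^ d) ((N ℕ.* L) ℕ.^ suc d) ⟩
      ι (g ℕ.* n ℕ.^ d) * ι ((N ℕ.* L) ℕ.^ suc d)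
        ≤⟨ *-monoˡ (0≤ι ((N ℕ.* L) ℕ.^ suc d)) gn^d≤s^h ⟩
      s ^ suc d * ι ((N ℕ.* L) ℕ.^ suc d)
        ≡⟨ cong (s ^ suc d *_) (ι-^ (N ℕ.* L) (suc d)) ⟩
      s ^ suc d * ι (N ℕ.* L) ^ suc d
        ≡⟨ ^-distrib-* s (ι (N ℕ.* L)) (suc d) ⟨
      (s * ι (N ℕ.* L)) ^ suc d ∎)
      where open ≤-Reasoning

    -- All terms are scaled by `L * n`. Since `N * L = L * n + L * L`, the root bound splits into
    -- the main term `s` and an error `4 * K * e`; the remaining `4 * d * e` comes from the
    -- truncation at `d`.
    estimate : s ≤ ι (K ℕ.* (2 ℕ.* e ℕ.* (2 ℕ.* e))) →
               ι m ≤ s + ι (4 ℕ.* (K ℕ.+ d) ℕ.* e)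
    estimate s≤ = *-cancelʳ-≤-pos (ι Ln) {{positive (0<ι Ln)}} (begin
      ι m * ι Ln
        ≡⟨ ι-* m Ln ⟨
      ι (m ℕ.* Ln)
        ≤⟨ ι-mono-≤ length-boundℕ ⟩
      ι (M ℕ.* n ℕ.+ D ℕ.* Ln)
        ≡⟨ ι-+ (M ℕ.* n) (D ℕ.* Ln) ⟩
      ι (M ℕ.* n) + ι (D ℕ.* Ln)
        ≤⟨ +-monoˡ-≤ (ι (D ℕ.* Ln)) (≤-trans root-bound squares) ⟩
      s * ι Ln + ι (E ℕ.* Ln) + ι (D ℕ.* Ln)
        ≡⟨ +-assoc (s * ι Ln) (ι (E ℕ.* Ln)) (ι (D ℕ.* Ln)) ⟩
      s * ι Ln + (ι (E ℕ.* Ln) + ι (D ℕ.* Ln))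
        ≡⟨ cong (s * ι Ln +_) (ι-+ (E ℕ.* Ln) (D ℕ.* Ln)) ⟨
      s * ι Ln + ι (E ℕ.* Ln ℕ.+ D ℕ.* Ln)
        ≡⟨ cong (λ x → s * ι Ln + ι x) (collect K d e Ln) ⟩
      s * ι Ln + ι (4 ℕ.* (K ℕ.+ d) ℕ.* e ℕ.* Ln)
        ≡⟨ cong (s * ι Ln +_) (ι-* (4 ℕ.* (K ℕ.+ d) ℕ.* e) Ln) ⟩
      s * ι Ln + ι (4 ℕ.* (K ℕ.+ d) ℕ.* e) * ι Ln
        ≡⟨ *-distribʳ-+ (ι Ln) s (ι (4 ℕ.* (K ℕ.+ d) ℕ.* e)) ⟨
      (s + ι (4 ℕ.* (K ℕ.+ d) ℕ.* e)) * ι Ln ∎)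
      where
      open ≤-Reasoning
      Ln E D : ℕ
      Ln = L ℕ.* n
      E  = 4 ℕ.* K ℕ.* e
      D  = 4 ℕ.* d ℕ.* e
      instance
        Ln≢0 : ℕ.NonZero Ln
        Ln≢0 = ℕ.m*n≢0 L n
      collect : ∀ K d e x → 4 ℕ.* K ℕ.* e ℕ.* x ℕ.+ 4 ℕ.* d ℕ.* e ℕ.* x ≡ 4 ℕ.* (K ℕ.+ d) ℕ.* e ℕ.* x
      collect = solve-∀
      split : ∀ L n → (L ℕ.+ n) ℕ.* L ≡ L ℕ.* n ℕ.+ L ℕ.* L
      split = solve-∀
      squares : s * ι (N ℕ.* L) ≤ s * ι Ln + ι (E ℕ.* Ln)
      squares = begin
        s * ι (N ℕ.* L)
          ≡⟨ cong (s *_) (trans (cong ι (split L n)) (ι-+ Ln (L ℕ.* L))) ⟩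
        s * (ι Ln + ι (L ℕ.* L))
          ≡⟨ *-distribˡ-+ s (ι Ln) (ι (L ℕ.* L)) ⟩
        s * ι Ln + s * ι (L ℕ.* L)
          ≤⟨ +-monoʳ-≤ (s * ι Ln) (begin
               s * ι (L ℕ.* L)   ≤⟨ *-monoˡ (0≤ι (L ℕ.* L)) s≤ ⟩
               ι (K ℕ.* (2 ℕ.* e ℕ.* (2 ℕ.* e))) * ι (L ℕ.* L)
                                 ≡⟨ ι-* (K ℕ.* (2 ℕ.* e ℕ.* (2 ℕ.* e))) (L ℕ.* L) ⟨
               ι (K ℕ.* (2 ℕ.* e ℕ.* (2 ℕ.* e)) ℕ.* (L ℕ.* L))
                                 ≤⟨ ι-mono-≤ (square-boundℕ K) ⟩
               ι (E ℕ.* Ln)      ∎) ⟩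
        s * ι Ln + ι (E ℕ.* Ln) ∎

-- Subsets of [n] as 0-1 sequences.

module Subsets where

  open Counting using (shift; shift-pos)
  open import Algebra.Properties.Semiring.Sum ℕ.+-*-semiring using (sum-syntax)
  open import Data.Bool.Base using (true; false)
  open import Data.Fin.Base using (Fin; zero; suc; toℕ)
  open import Data.Fin.Properties using (toℕ-injective)
  open import Data.Fin.Subset using (Subset; ∣_∣) renaming (_∈_ to _∈ₛ_)
  open import Data.Integer.Base as ℤ using (ℤ; +_)
  import Data.Integer.Properties as ℤ
  open import Data.Nat.Base
  open import Data.Product.Base using (∃-syntax; _×_; _,_)
  open import Data.Vec.Base using ([]; _∷_; here; there)
  open import Defs using (IsC; ⟦_⟧)
  open import Function.Definitions using (Injective)
  open import Relation.Binary.PropositionalEquality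
  open import Relation.Nullary using (¬_)

  private
    variable
      n : ℕ

  -- Defined on all of ℕ, with value 0 from `n` on, so that it can be shifted.
  indicator : Subset n → ℕ → ℕ
  indicator []          i       = 0
  indicator (_     ∷ A) (suc i) = indicator A i
  indicator (true  ∷ A) zero    = 1
  indicator (false ∷ A) zero    = 0

  indicator≤1 : (A : Subset n) → ∀ i → indicator A i ≤ 1
  indicator≤1 []          i       = z≤n
  indicator≤1 (true  ∷ A) zero    = ℕ.≤-refl
  indicator≤1 (false ∷ A) zero    = z≤n
  indicator≤1 (_     ∷ A) (suc i) = indicator≤1 A i

  sum-indicator : (A : Subset n) → ∑[ i < n ] indicator A (toℕ i) ≡ ∣ A ∣
  sum-indicator []          = refl
  sum-indicator (true  ∷ A) = cong suc (sum-indicator A)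
  sum-indicator (false ∷ A) = sum-indicator A

  indicator-pos : (A : Subset n) → ∀ i → 0 < indicator A i → ∃[ a ] (a ∈ₛ A × i ≡ toℕ a)
  indicator-pos (true ∷ A) zero    _   = zero , here , refl
  indicator-pos (_    ∷ A) (suc i) 0<A with a , a∈A , i≡a ← indicator-pos A i 0<A =
    suc a , there a∈A , cong suc i≡a

  -- In the notation of C_h[g]: X = {-t : t ∈ τ} and the translations are i + 1 for i ∈ κ.
  noPattern : ∀ {h g u N} {A : Subset n} → IsC ℤ.+-0-abelianGroup h g ⟦ A ⟧ →
    (τ : Fin h → Fin u) → Injective _≡_ _≡_ τ →
    (κ : Fin g → Fin N) → Injective _≡_ _≡_ κ →
    ¬ (∀ i j → 0 < shift (toℕ (τ j)) (indicator A) (toℕ (κ i)))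
  noPattern {A = A} isC τ τ-inj κ κ-inj pos
    with i , escapes ← isC
      (λ j → ℤ.- (+ toℕ (τ j)))
      (λ eq → τ-inj (toℕ-injective (ℤ.+-injective (ℤ.neg-injective eq))))
      -- The `suc` matches `⟦_⟧`, where index `i` stands for the integer i + 1.
      (λ i → + suc (toℕ (κ i)))
      (λ eq → κ-inj (toℕ-injective (ℕ.suc-injective (ℤ.+-injective eq)))) =
    escapes contained
    where
    cancel : ∀ t m → ℤ.- (+ t) ℤ.+ + suc (t + m) ≡ + suc m
    cancel t m = begin
      ℤ.- (+ t) ℤ.+ + suc (t + m)        ≡⟨ cong (λ x → ℤ.- (+ t) ℤ.+ + x) (ℕ.+-suc t m) ⟨
      ℤ.- (+ t) ℤ.+ (+ t ℤ.+ + suc m)    ≡⟨ ℤ.+-assoc (ℤ.- (+ t)) (+ t) (+ suc m) ⟨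
      ℤ.- (+ t) ℤ.+ + t ℤ.+ + suc m      ≡⟨ cong (ℤ._+ + suc m) (ℤ.+-inverseˡ (+ t)) ⟩
      ℤ.0ℤ ℤ.+ + suc m                   ≡⟨ ℤ.+-identityˡ (+ suc m) ⟩
      + suc m                            ∎
      where open ≡-Reasoning

    contained : ∀ {i z} → ∃[ j ] z ≡ ℤ.- (+ toℕ (τ j)) ℤ.+ + suc (toℕ (κ i)) → ⟦ A ⟧ z
    contained {i} (j , refl)
      with m , κi≡ , 0<Am ← shift-pos (toℕ (τ j)) (toℕ (κ i)) (pos i j)
      with a , a∈A , refl ← indicator-pos A m 0<Am =
      a , a∈A , trans (cong (λ x → ℤ.- (+ toℕ (τ j)) ℤ.+ + suc x) κi≡) (cancel (toℕ (τ j)) (toℕ a))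

  window-bound : ∀ d g u (A : Subset n) → IsC ℤ.+-0-abelianGroup (suc d) (suc g) ⟦ A ⟧ →
    (u * ∣ A ∣ ∸ (u + n) * d) ^ suc d ≤ (u + n) ^ d * (g * u ^ suc d)
  window-bound {n} d g u A isC =
    subst (λ M → (u * M ∸ (u + n) * d) ^ suc d ≤ (u + n) ^ d * (g * u ^ suc d)) (sum-indicator A)
      (Counting.window-bound d g u n (indicator A) (indicator≤1 A) (noPattern {A = A} isC))

-- The choice of window length, and the bound for rational majorants.

module RationalBound where

  open import Data.Fin.Subset using (Subset; ∣_∣)
  open import Data.Integer.Properties using (+-0-abelianGroup)
  open import Data.Nat.DivMod using (m≡m%n+[m/n]*n; m%n<n; m/n*n≤m; m≥n⇒m/n>0)
  open import Data.Rational.Base hiding (∣_∣)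
  open import Data.Rational.Properties hiding (+-0-abelianGroup)
  open import Data.Sum.Base using (inj₁; inj₂)
  open import Data.Product.Base using (_,_)
  open import Defs using (IsC; ⟦_⟧)
  open import Relation.Binary.PropositionalEquality using (refl; sym; cong; subst)
  open Powers
  open Rationals

  module _ (d g n : ℕ) .{{_ : ℕ.NonZero n}} (A : Subset n)
    (isC : IsC +-0-abelianGroup (suc d) (suc g) ⟦ A ⟧) where

    -- The constant of `estimate` for `K = suc g`.
    C : ℕ
    C = 4 ℕ.* (suc g ℕ.+ d)

    module _ (e : ℕ) (e^2h≤n^d : e ℕ.^ (2 ℕ.* suc d) ℕ.≤ n ℕ.^ d)
      (n^d<e⁺^2h : n ℕ.^ d ℕ.< suc e ℕ.^ (2 ℕ.* suc d))
      where

      instance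
        e≢0 : ℕ.NonZero e
        -- For `e = 0` the upper bound would read `n ^ d < 1`, although `n` is at least 1.
        e≢0 = ℕ.≢-nonZero λ { refl → ℕ.<⇒≱ n^d<e⁺^2h
          (subst (ℕ._≤ n ℕ.^ d) (sym (ℕ.^-zeroˡ (2 ℕ.* suc d))) (ℕ.m^n>0 n d)) }

      e≤n : e ℕ.≤ n
      e≤n = ^-cancelˡ-≤ (2 ℕ.* suc d) (ℕ.≤-trans e^2h≤n^d
        (ℕ.^-monoʳ-≤ n (ℕ.≤-trans (ℕ.n≤1+n d) (ℕ.m≤m+n (suc d) _))))

      L : ℕ
      L = n ℕ./ e

      instance
        L≢0 : ℕ.NonZero L
        L≢0 = ℕ.>-nonZero (m≥n⇒m/n>0 e≤n)

      -- The remainder is below `e`, and `e ≤ L * e` because `L` is positive.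
      n≤2Le : n ℕ.≤ 2 ℕ.* (L ℕ.* e)
      n≤2Le = begin
        n                        ≡⟨ m≡m%n+[m/n]*n n e ⟩
        n ℕ.% e ℕ.+ L ℕ.* e      ≤⟨ ℕ.+-monoˡ-≤ (L ℕ.* e)
                                      (ℕ.≤-trans (ℕ.<⇒≤ (m%n<n n e)) (ℕ.m≤n*m e L)) ⟩
        L ℕ.* e ℕ.+ L ℕ.* e      ≡⟨ cong (L ℕ.* e ℕ.+_) (ℕ.+-identityʳ (L ℕ.* e)) ⟨
        2 ℕ.* (L ℕ.* e)          ∎
        where open ℕ.≤-Reasoning

      open Estimate d g n L e ∣ A ∣ (Subsets.window-bound d g L A isC) (m/n*n≤m n e) n≤2Le
        using (estimate)

      cap : ℕ
      cap = suc g ℕ.* (2 ℕ.* e ℕ.* (2 ℕ.* e))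

      -- `2 * e` is at least `suc e` and so exceeds n^(d/(2h)); its square exceeds n^(d/h), and the
      -- factor `suc g` absorbs the h-th root of `g`.
      gn^d≤cap^h : g ℕ.* n ℕ.^ d ℕ.≤ cap ℕ.^ suc d
      gn^d≤cap^h = begin
        g ℕ.* n ℕ.^ d
          ≤⟨ ℕ.*-mono-≤ (ℕ.≤-trans (ℕ.n≤1+n g) (ℕ.m≤m*n (suc g) (suc g ℕ.^ d) {{ℕ.m^n≢0 (suc g) d}}))
               (ℕ.<⇒≤ n^d<e⁺^2h) ⟩
        suc g ℕ.^ suc d ℕ.* suc e ℕ.^ (2 ℕ.* suc d)
          ≤⟨ ℕ.*-monoʳ-≤ (suc g ℕ.^ suc d) (ℕ.^-monoˡ-≤ (2 ℕ.* suc d) e⁺≤2e) ⟩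
        suc g ℕ.^ suc d ℕ.* (2 ℕ.* e) ℕ.^ (2 ℕ.* suc d)
          ≡⟨ cong (suc g ℕ.^ suc d ℕ.*_) (ℕ.^-*-assoc (2 ℕ.* e) 2 (suc d)) ⟨
        suc g ℕ.^ suc d ℕ.* ((2 ℕ.* e) ℕ.^ 2) ℕ.^ suc d
          ≡⟨ cong (λ x → suc g ℕ.^ suc d ℕ.* (2 ℕ.* e ℕ.* x) ℕ.^ suc d) (ℕ.*-identityʳ (2 ℕ.* e)) ⟩
        suc g ℕ.^ suc d ℕ.* (2 ℕ.* e ℕ.* (2 ℕ.* e)) ℕ.^ suc d
          ≡⟨ ^-distribʳ-* (suc d) (suc g) (2 ℕ.* e ℕ.* (2 ℕ.* e)) ⟨
        cap ℕ.^ suc d ∎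
        where
        open ℕ.≤-Reasoning
        e⁺≤2e : suc e ℕ.≤ 2 ℕ.* e
        e⁺≤2e = ℕ.≤-trans (ℕ.+-monoˡ-≤ e (ℕ.>-nonZero⁻¹ e))
          (ℕ.≤-reflexive (cong (e ℕ.+_) (sym (ℕ.+-identityʳ e))))

      -- s is an arbitrary rational upper bound of ((g - 1) n^d)^(1/h), but the
      -- error term s L / n is O(e) only for s = O(e²).
      capped : ∀ {s} → 0ℚ ≤ s → ι (g ℕ.* n ℕ.^ d) ≤ s ^ suc d → ι ∣ A ∣ ≤ s + ι (C ℕ.* e)
      capped {s} 0≤s gn^d≤s^h with ≤-total s (ι cap)
      ... | inj₁ s≤cap = estimate (suc g) 0≤s gn^d≤s^h s≤cap
      -- `cap` is itself an admissible majorant, and its estimate implies the one for any larger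
      -- `s`.
      ... | inj₂ cap≤s = ≤-trans
        (estimate (suc g) (0≤ι cap)
          (subst (ι (g ℕ.* n ℕ.^ d) ≤_) (ι-^ cap (suc d)) (ι-mono-≤ gn^d≤cap^h)) ≤-refl)
        (+-monoˡ-≤ (ι (C ℕ.* e)) cap≤s)

    -- `w` is a rational above n^(d/(2h)), hence above the floor `e` of that number.
    bound : ∀ {s w} → 0ℚ ≤ s → ι (g ℕ.* n ℕ.^ d) ≤ s ^ suc d →
      0ℚ ≤ w → ι (n ℕ.^ d) < w ^ (2 ℕ.* suc d) → ι ∣ A ∣ ≤ s + ι C * w
    bound {s} {w} 0≤s gn^d≤s^h 0≤w n^d<w^2h
      with e , e^2h≤n^d , n^d<e⁺^2h ← floorRoot (2 ℕ.* suc d) (n ℕ.^ d) = begin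
      ι ∣ A ∣            ≤⟨ capped e e^2h≤n^d n^d<e⁺^2h 0≤s gn^d≤s^h ⟩
      s + ι (C ℕ.* e)    ≡⟨ cong (λ x → s + x) (ι-* C e) ⟩
      s + ι C * ι e      ≤⟨ +-monoʳ-≤ s (*-monoʳ (0≤ι C) (<⇒≤ e<w)) ⟩
      s + ι C * w        ∎
      where
      open ≤-Reasoning
      e<w : ι e < w
      e<w = ^-cancel-< (2 ℕ.* suc d) 0≤w (≤-<-trans
        (subst (_≤ ι (n ℕ.^ d)) (ι-^ e (2 ℕ.* suc d)) (ι-mono-≤ e^2h≤n^d)) n^d<w^2h)

-- Passage to real numbers as upper cuts.

open import Defs
open import Data.Fin.Subset using (Subset; ∣_∣)
open import Data.Integer.Properties using (+-0-abelianGroup)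
open import Data.Product.Base using (∃-syntax; _,_)
open import Relation.Binary.PropositionalEquality using (subst)
open import Relation.Unary using (_⊆_)
open Rationals using (_^_; ^-nonNeg; ι; ι-*; 0≤ι; *-monoˡ; *-monoʳ; *-monoˡ-<; *-nonNeg; ^-distrib-*)
open ℝ≥0

-- Replaces membership in a `k`-fold product of cuts by one inequality of rationals,
-- `ι (m ^ k) < q`.
above-^ℕ : ∀ m k → above (fromℕ m ^ℕ k) ⊆ above (fromℕ (m ℕ.^ k))
above-^ℕ m zero    1<q = 1<q
above-^ℕ m (suc k) {q} (s , t , m<s , t∈ , st≤q) = begin-strict
  ι (m ℕ.* m ℕ.^ k)      ≡⟨ ι-* m (m ℕ.^ k) ⟩
  ι m ℚ.* ι (m ℕ.^ k)    ≤⟨ *-monoʳ (0≤ι m) (ℚ.<⇒≤ (above-^ℕ m k {t} t∈)) ⟩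
  ι m ℚ.* t              <⟨ *-monoˡ-< (pos (fromℕ m ^ℕ k) t∈) m<s ⟩
  s ℚ.* t                ≤⟨ st≤q ⟩
  q                      ∎
  where open ℚ.≤-Reasoning

theorem1 : ∀ (g h : ℕ) → h ℕ.≤ g → 2 ℕ.≤ h →
    ∃[ C ] (∀ (n : ℕ) → 1 ℕ.≤ n →
    ∀ (A : Subset n) → IsC +-0-abelianGroup h g ⟦ A ⟧ →
    fromℕ ∣ A ∣ ≤ fromℕ (g ∸ 1) ^[ 1 / h ] * fromℕ n ^[ h ∸ 1 / h ]
    + C * fromℕ n ^[ h ∸ 1 / 2 ℕ.* h ])
-- By the definition of `_≤_`, any rational `q` above the right side must lie above the left.
-- Unpacking the sum and the products gives rationals `p`, `v`, `c`, `w` above (g - 1)^(1/h),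
-- n^((h-1)/h), the constant and n^((h-1)/(2h)), where g and h are those of the statement.
theorem1 (suc g) (suc d) _ _ = fromℕ C , λ where
    n 1≤n A isC {q} (s , t , (p , v , (0<p , p^h∈) , (0<v , v^h∈) , pv≤s) ,
                     (c , w , C<c , (0<w , w^2h∈) , cw≤t) , s+t≤q) →
      let instance
            n≢0 : ℕ.NonZero n
            n≢0 = ℕ.>-nonZero 1≤n
          0≤pv = *-nonNeg (ℚ.<⇒≤ 0<p) (ℚ.<⇒≤ 0<v)
          g<p^h : ι g ℚ.< p ^ suc d
          g<p^h = subst (λ x → ι x ℚ.< p ^ suc d) (ℕ.*-identityʳ g)
            (above-^ℕ g 1 {p ^ suc d} p^h∈)
          n^d<v^h : ι (n ℕ.^ d) ℚ.< v ^ suc d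
          n^d<v^h = above-^ℕ n d {v ^ suc d} v^h∈
          gn^d≤[pv]^h : ι (g ℕ.* n ℕ.^ d) ℚ.≤ (p ℚ.* v) ^ suc d
          gn^d≤[pv]^h = begin
            ι (g ℕ.* n ℕ.^ d)          ≡⟨ ι-* g (n ℕ.^ d) ⟩
            ι g ℚ.* ι (n ℕ.^ d)        ≤⟨ *-monoʳ (0≤ι g) (ℚ.<⇒≤ n^d<v^h) ⟩
            ι g ℚ.* v ^ suc d          ≤⟨ *-monoˡ (^-nonNeg (suc d) (ℚ.<⇒≤ 0<v)) (ℚ.<⇒≤ g<p^h) ⟩
            p ^ suc d ℚ.* v ^ suc d    ≡⟨ ^-distrib-* p v (suc d) ⟨
            (p ℚ.* v) ^ suc d          ∎
      in begin-strict
        ι ∣ A ∣                 ≤⟨ RationalBound.bound d g n A isC 0≤pv gn^d≤[pv]^h (ℚ.<⇒≤ 0<w)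
                                     (above-^ℕ n d {w ^ (2 ℕ.* suc d)} w^2h∈) ⟩
        -- The strictness demanded by the cut comes from `C<c` and `0<w`.
        p ℚ.* v ℚ.+ ι C ℚ.* w   <⟨ ℚ.+-monoʳ-< (p ℚ.* v) (*-monoˡ-< 0<w C<c) ⟩
        p ℚ.* v ℚ.+ c ℚ.* w     ≤⟨ ℚ.+-mono-≤ pv≤s cw≤t ⟩
        s ℚ.+ t                 ≤⟨ s+t≤q ⟩
        q                       ∎
  where
  open ℚ.≤-Reasoning
  C : ℕ
  C = 4 ℕ.* (suc g ℕ.+ d)
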